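{- For positive integers $a,b,c$ with $a \le b \le c$, we have $$N(abc) \ge \min\{N(a)+1,\,N(b),\,N(c)\},$$ where $N(n)$ denotes the maximum number of mutually orthogonal latin squares of order $n$.
   Context: A latin square of order $n$ is an $n\times n$ array with entries from an $n$-element symbol set such that each row and each column contains every symbol exactly once. Two latin squares $L=(L_{ij})$ and $M=(M_{ij})$ of order $n$ are orthogonal if the $n^2$ ordered pairs $(L_{ij},M_{ij})$, $1\le i,j\le n$, are all distinct. A family of pairwise orthogonal latin squares is called mutually orthogonal latin squares (MOLS). $N(n)$ is the maximum size of a family of MOLS of order $n$ (with the standard convention that $N(1)=\infty$). -}

module Defs where

open import Data.Nat using (ℕ)
open import Data.Fin using (Fin)
open import Data.Product using (Σ; _×_; _,_; ∃-syntax)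
open import Relation.Binary.PropositionalEquality using (_≡_)
open import Relation.Nullary using (¬_)

Array : ℕ → Set
Array n = Fin n → Fin n → Fin n

IsLatin : {n : ℕ} → Array n → Set
IsLatin {n} L =
  ((i s : Fin n) → ∃[ j ] (L i j ≡ s × ((j′ : Fin n) → L i j′ ≡ s → j′ ≡ j))) ×
  ((j s : Fin n) → ∃[ i ] (L i j ≡ s × ((i′ : Fin n) → L i′ j ≡ s → i′ ≡ i)))

Orthogonal : {n : ℕ} → Array n → Array n → Set
Orthogonal {n} L M =
  (i j i′ j′ : Fin n) → L i j ≡ L i′ j′ → M i j ≡ M i′ j′ → (i ≡ i′ × j ≡ j′)

MOLS : ℕ → ℕ → Set
MOLS k n = Σ (Fin k → Array n) λ F →
  ((t : Fin k) → IsLatin (F t)) ×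
  ((t u : Fin k) → ¬ (t ≡ u) → Orthogonal (F t) (F u))

-- "k ≤ N(n)": since N(n) is the maximum size of a MOLS family (N(1) = ∞)
-- and subfamilies of MOLS are MOLS, k ≤ N(n) holds iff a family of k MOLS
-- of order n exists.
_≤N_ : ℕ → ℕ → Set
k ≤N n = MOLS k n

{-# OPTIONS --safe #-}

-- k MOLS of order n are the same thing as k + 2 pairwise "orthogonal" columns
-- on n² rows.  Let A have columns α_j (j ∈ J) and let B and C have columns
-- β_j, γ_j together with one more column β_*, γ_*; a column * is wanted for the
-- product.  Write c = w + p a with w < a and b = a + d.
--
-- The rows of A are relabelled according to γ_* ∈ W ⊎ (P × A): x_j = α_j for
-- γ_* ∈ W and x_j = i + α_j for γ_* = (q , i).  For fixed q and α the a pairs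
-- (α , (q , i)) form a "unit": each x_j takes every value in A once on it.  The
-- pairs (α , e), α arbitrary, take every value of x_j exactly a times, so
-- together with d units they form a "bin", on which x_j takes every value b
-- times.  Since w d ≤ p a², there are enough units to complete all w bins.
-- Labelling the occurrences of each value inside a bin by B and using the label
-- to translate β_j makes each pair (bin , row of B) a parallel class; each
-- pair (leftover unit , β_*) is one as well.  This amounts to
-- w b² + (p a² − w d) b = a b c classes, which are the symbols of column *.

module Submission where

open import Defs
open import Data.Fin using (Fin; zero; suc; toℕ; fromℕ<; cast; splitAt; join; combine; remQuot; punchOut)
open import Data.Fin.Properties using (_≟_; any?; toℕ<n; toℕ-fromℕ<; toℕ-injective; suc-injective; injective⇒≤; punchOut-injective; cast-involutive; combine-injective; combine-remQuot; remQuot-combine; join-splitAt; splitAt-join)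
open import Data.Nat using (ℕ; suc; _+_; _*_; _∸_; _≤_; NonZero; >-nonZero)
open import Data.Nat.DivMod using (_/_; _%_; m%n<n; m%n≤n; m%n%n≡m%n; m<n⇒m%n≡m; m≡m%n+[m/n]*n; [m+n]%n≡m%n; %-distribˡ-+)
open import Data.Nat.Properties using (+-comm; +-assoc; m+[n∸m]≡n; <⇒≤; 1+n≰n; ≤-trans; *-mono-≤; +-monoˡ-≤; +-cancelˡ-≤; m≤n⇒∃[o]m+o≡n)
open import Data.Nat.Tactic.RingSolver using (solve-∀)
open import Data.Product using (_×_; _,_; ∃-syntax; proj₁; proj₂; map; uncurry)
open import Data.Product.Properties using (,-injectiveˡ; ,-injectiveʳ)
open import Data.Sum using (_⊎_; inj₁; inj₂; map₁)
import Data.Sum as Sum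
open import Data.Sum.Properties using (inj₁-injective; inj₂-injective)
open import Function using (_∘_; _∋_; id)
open import Function.Definitions using (Injective)
open import Relation.Binary.PropositionalEquality using (_≡_; _≢_; refl; sym; trans; cong; cong₂; subst; module ≡-Reasoning)
open import Relation.Nullary using (yes; no; contradiction)

-- Injections and surjections between finite types.

private variable
  A B C D R S T J : Set
  n : ℕ

Inj : (A → B) → Set
Inj f = Injective _≡_ _≡_ f

inverseˡ⇒Inj : (f : A → B) (g : B → A) → (∀ x → g (f x) ≡ x) → Inj f
inverseˡ⇒Inj f g gf {x} {y} eq = trans (sym (gf x)) (trans (cong g eq) (gf y))

×-Inj : {f : A → B} {g : C → D} → Inj f → Inj g → Inj (map f g)
×-Inj f-inj g-inj eq =
  cong₂ _,_ (f-inj (,-injectiveˡ eq)) (g-inj (,-injectiveʳ eq))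

⊎-Inj : {f : A → B} {g : C → D} → Inj f → Inj g → Inj (Sum.map f g)
⊎-Inj f-inj g-inj {inj₁ _} {inj₁ _} eq = cong inj₁ (f-inj (inj₁-injective eq))
⊎-Inj f-inj g-inj {inj₂ _} {inj₂ _} eq = cong inj₂ (g-inj (inj₂-injective eq))

splitAt-Inj : ∀ m {n} → Inj (splitAt m {n})
splitAt-Inj m {n} = inverseˡ⇒Inj (splitAt m) (join m n) (join-splitAt m n)

join-Inj : ∀ m n → Inj (join m n)
join-Inj m n = inverseˡ⇒Inj (join m n) (splitAt m) (splitAt-join m n)

remQuot-Inj : ∀ {m} n → Inj (remQuot {m} n)
remQuot-Inj {m} n = inverseˡ⇒Inj (remQuot n) (uncurry combine) (combine-remQuot {m} n)

combine-Inj : ∀ {m n} → Inj (uncurry (combine {m} {n}))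
combine-Inj {n = n} =
  inverseˡ⇒Inj (uncurry combine) (remQuot n) (uncurry remQuot-combine)

cast-Inj : ∀ {m n} (eq : m ≡ n) → Inj (cast eq)
cast-Inj eq = inverseˡ⇒Inj (cast eq) (cast (sym eq)) (cast-involutive (sym eq) eq)

-- Pigeonhole: punching out a missed value `y` would inject `Fin (suc n)` into `Fin n`.
Inj⇒surjective : (f : Fin n → Fin n) → Inj f → ∀ y → ∃[ x ] f x ≡ y
Inj⇒surjective {suc n} f f-inj y with any? (λ x → f x ≟ y)
... | yes x,fx≡y = x,fx≡y
... | no  ∄x     = contradiction (injective⇒≤ g-inj) 1+n≰n
  where
  y≢f : ∀ x → y ≢ f x
  y≢f x y≡fx = ∄x (x , sym y≡fx)

  g-inj : Inj (λ x → punchOut (y≢f x))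
  g-inj = f-inj ∘ punchOut-injective (y≢f _) (y≢f _)

Inj⇒surjective² : (f : Fin n × Fin n → Fin n × Fin n) → Inj f → ∀ y → ∃[ x ] f x ≡ y
Inj⇒surjective² {n} f f-inj y =
  let z , eq = Inj⇒surjective (uncurry combine ∘ f ∘ remQuot n)
                 (remQuot-Inj n ∘ f-inj ∘ combine-Inj) (uncurry combine y)
  in remQuot n z , combine-Inj eq

-- Cyclic addition on `Fin n`.

module _ {n : ℕ} .{{_ : NonZero n}} where

  infixl 6 _⊕_

  _⊕_ : Fin n → Fin n → Fin n
  i ⊕ j = fromℕ< (m%n<n (toℕ i + toℕ j) n)

  ⊕-comm : ∀ i j → i ⊕ j ≡ j ⊕ i
  ⊕-comm i j = toℕ-injective (trans (toℕ-fromℕ< _)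
    (trans (cong (_% n) (+-comm (toℕ i) (toℕ j))) (sym (toℕ-fromℕ< _))))

  -- Source of cancellation: adding the complement `n ∸ m` inverts adding `m` modulo `n`.
  [[m+j]%n+[n∸m]]%n≡j : ∀ {m} → m ≤ n → (j : Fin n) →
                        ((m + toℕ j) % n + (n ∸ m)) % n ≡ toℕ j
  [[m+j]%n+[n∸m]]%n≡j {m} m≤n j = begin
    ((m + k) % n + (n ∸ m)) % n               ≡⟨ %-distribˡ-+ ((m + k) % n) (n ∸ m) n ⟩
    ((m + k) % n % n + (n ∸ m) % n) % n       ≡⟨ cong (λ z → (z + (n ∸ m) % n) % n) (m%n%n≡m%n (m + k) n) ⟩
    ((m + k) % n + (n ∸ m) % n) % n           ≡⟨ %-distribˡ-+ (m + k) (n ∸ m) n ⟨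
    (m + k + (n ∸ m)) % n                     ≡⟨ cong (λ z → (z + (n ∸ m)) % n) (+-comm m k) ⟩
    (k + m + (n ∸ m)) % n                     ≡⟨ cong (_% n) (+-assoc k m (n ∸ m)) ⟩
    (k + (m + (n ∸ m))) % n                   ≡⟨ cong (λ z → (k + z) % n) (m+[n∸m]≡n m≤n) ⟩
    (k + n) % n                               ≡⟨ [m+n]%n≡m%n k n ⟩
    k % n                                     ≡⟨ m<n⇒m%n≡m (toℕ<n j) ⟩
    k                                         ∎
    where
    open ≡-Reasoning
    k = toℕ j

  ⊕-cancelˡ : ∀ i → Inj (i ⊕_)
  ⊕-cancelˡ i {j} {k} eq = toℕ-injective (begin
    toℕ j                                             ≡⟨ [[m+j]%n+[n∸m]]%n≡j (<⇒≤ (toℕ<n i)) j ⟨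
    ((toℕ i + toℕ j) % n + (n ∸ toℕ i)) % n           ≡⟨ cong (λ z → (z + (n ∸ toℕ i)) % n) [i+j]≡[i+k] ⟩
    ((toℕ i + toℕ k) % n + (n ∸ toℕ i)) % n           ≡⟨ [[m+j]%n+[n∸m]]%n≡j (<⇒≤ (toℕ<n i)) k ⟩
    toℕ k                                             ∎)
    where
    open ≡-Reasoning
    [i+j]≡[i+k] = trans (sym (toℕ-fromℕ< _)) (trans (cong toℕ eq) (toℕ-fromℕ< _))

  ⊕-cancelʳ : ∀ i → Inj (_⊕ i)
  ⊕-cancelʳ i {j} {k} eq =
    ⊕-cancelˡ i (trans (⊕-comm i j) (trans eq (⊕-comm k i)))

-- Translation between MOLS and orthogonal columns.

JointlyInjective : (R → S) → (R → T) → Set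
JointlyInjective f g = ∀ {r r′} → f r ≡ f r′ → g r ≡ g r′ → r ≡ r′

OrthogonalColumns : (J → R → S) → Set
OrthogonalColumns col = ∀ {j j′} → j ≢ j′ → JointlyInjective (col j) (col j′)

squareColumns : ∀ {k} → (Fin k → Array n) → Fin (2 + k) → Fin n × Fin n → Fin n
squareColumns F zero          (i , j) = i
squareColumns F (suc zero)    (i , j) = j
squareColumns F (suc (suc t)) (i , j) = F t i j

MOLS⇒OrthogonalColumns : ∀ {k} ((F , _) : MOLS k n) → OrthogonalColumns (squareColumns F)
MOLS⇒OrthogonalColumns {n} (F , latin , orth) = go _ _
  where
  row : ∀ t {i j j′ : Fin n} → F t i j ≡ F t i j′ → j ≡ j′
  row t {i} {j} {j′} eq =
    let _ , _ , unique = proj₁ (latin t) i (F t i j′)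
    in trans (unique j eq) (sym (unique j′ refl))

  column : ∀ t {i i′ j : Fin n} → F t i j ≡ F t i′ j → i ≡ i′
  column t {i} {i′} {j} eq =
    let _ , _ , unique = proj₂ (latin t) j (F t i′ j)
    in trans (unique i eq) (sym (unique i′ refl))

  go : ∀ u v → u ≢ v → JointlyInjective (squareColumns F u) (squareColumns F v)
  go zero          zero          u≢v _    _    = contradiction refl u≢v
  go zero          (suc zero)    _   refl refl = refl
  go zero          (suc (suc t)) _   refl eq   = cong (_ ,_) (row t eq)
  go (suc zero)    zero          _   refl refl = refl
  go (suc zero)    (suc zero)    u≢v _    _    = contradiction refl u≢v
  go (suc zero)    (suc (suc t)) _   refl eq   = cong (_, _) (column t eq)
  go (suc (suc t)) zero          _   eq   refl = cong (_ ,_) (row t eq)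
  go (suc (suc t)) (suc zero)    _   eq   refl = cong (_, _) (column t eq)
  go (suc (suc t)) (suc (suc u)) t≢u eq   eq′  =
    uncurry (cong₂ _,_) (orth t u (t≢u ∘ cong (λ v → suc (suc v))) _ _ _ _ eq eq′)

-- On `n * n` rows joint injectivity forces every pair of values to occur. Columns 0 and 1 thus
-- serve as coordinates of the cells, and each further column fills one square.
OrthogonalColumns⇒MOLS : ∀ {k} (col : Fin (2 + k) → Fin n × Fin n → Fin n) →
                         OrthogonalColumns col → MOLS k n
OrthogonalColumns⇒MOLS {n} {k} col orth =
  square , (λ t → latinRow t , latinColumn t) , orthogonal
  where
  0F 1F : Fin (2 + k)
  0F = zero
  1F = suc zero

  rowAt : ∀ {u v} → u ≢ v → ∀ i j → ∃[ r ] (col u r ≡ i × col v r ≡ j)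
  rowAt {u} {v} u≢v i j =
    let r , eq = Inj⇒surjective² (λ r → col u r , col v r)
                   (λ eq → orth u≢v (,-injectiveˡ eq) (,-injectiveʳ eq)) (i , j)
    in r , ,-injectiveˡ eq , ,-injectiveʳ eq

  r[_,_] : Fin n → Fin n → Fin n × Fin n
  r[ i , j ] = proj₁ (rowAt {0F} {1F} (λ ()) i j)

  col₀ : ∀ i j → col 0F r[ i , j ] ≡ i
  col₀ i j = proj₁ (proj₂ (rowAt {0F} {1F} (λ ()) i j))

  col₁ : ∀ i j → col 1F r[ i , j ] ≡ j
  col₁ i j = proj₂ (proj₂ (rowAt {0F} {1F} (λ ()) i j))

  r-unique : ∀ {r i j} → col 0F r ≡ i → col 1F r ≡ j → r[ i , j ] ≡ r
  r-unique {r} {i} {j} eq₀ eq₁ =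
    orth {0F} {1F} (λ ()) (trans (col₀ i j) (sym eq₀)) (trans (col₁ i j) (sym eq₁))

  square : Fin k → Array n
  square t i j = col (suc (suc t)) r[ i , j ]

  latinRow : ∀ t i s → ∃[ j ] (square t i j ≡ s × (∀ j′ → square t i j′ ≡ s → j′ ≡ j))
  latinRow t i s =
    let r , eq₀ , eqₜ = rowAt {0F} {suc (suc t)} (λ ()) i s
    in col 1F r
     , trans (cong (col (suc (suc t))) (r-unique eq₀ refl)) eqₜ
     , λ j′ eq → trans (sym (col₁ i j′)) (cong (col 1F)
         (orth {0F} {suc (suc t)} (λ ()) (trans (col₀ i j′) (sym eq₀)) (trans eq (sym eqₜ))))

  latinColumn : ∀ t j s → ∃[ i ] (square t i j ≡ s × (∀ i′ → square t i′ j ≡ s → i′ ≡ i))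
  latinColumn t j s =
    let r , eq₁ , eqₜ = rowAt {1F} {suc (suc t)} (λ ()) j s
    in col 0F r
     , trans (cong (col (suc (suc t))) (r-unique refl eq₁)) eqₜ
     , λ i′ eq → trans (sym (col₀ i′ j)) (cong (col 0F)
         (orth {1F} {suc (suc t)} (λ ()) (trans (col₁ i′ j) (sym eq₁)) (trans eq (sym eqₜ))))

  orthogonal : ∀ t u → t ≢ u → Orthogonal (square t) (square u)
  orthogonal t u t≢u i j i′ j′ eqₜ eqᵤ =
    trans (sym (col₀ i j)) (trans (cong (col 0F) same) (col₀ i′ j′)) ,
    trans (sym (col₁ i j)) (trans (cong (col 1F) same) (col₁ i′ j′))
    where
    same : r[ i , j ] ≡ r[ i′ , j′ ]
    same = orth (t≢u ∘ suc-injective ∘ suc-injective) eqₜ eqᵤ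

-- The product construction over abstract sets.

module Construction
  {A B C D W P U Rᴬ Rᴮ Rᶜ J : Set}
  (other : J → J) (other-≢ : ∀ j → j ≢ other j)
  (α : J → Rᴬ → A) (α-orth : OrthogonalColumns α)
  (β : J → Rᴮ → B) (β-orth : OrthogonalColumns β)
  (β* : Rᴮ → B) (β*-orth : ∀ j → JointlyInjective (β j) β*)
  (γ : J → Rᶜ → C) (γ-orth : OrthogonalColumns γ)
  (γ* : Rᶜ → W ⊎ P × A) (γ*-orth : ∀ j → JointlyInjective (γ j) γ*)
  (_+ᴬ_ : A → A → A) (+ᴬ-cancelˡ : ∀ x → Inj (x +ᴬ_)) (+ᴬ-cancelʳ : ∀ x → Inj (_+ᴬ x))
  (_+ᴮ_ : B → B → B) (+ᴮ-cancelˡ : ∀ x → Inj (x +ᴮ_)) (+ᴮ-cancelʳ : ∀ x → Inj (_+ᴮ x))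
  (ι : A ⊎ D → B) (ι-inj : Inj ι)
  -- A unit is a pair in `P × Rᴬ`. It either fills one of the `D` free places of a bin in `W` or is
  -- left over, indexed by `U`.
  (slot : P × Rᴬ → (W × D) ⊎ U) (slot-inj : Inj slot)
  where

  V : Set
  V = W ⊎ P × A

  x : J → V → Rᴬ → A
  x j (inj₁ e)       r = α j r
  x j (inj₂ (q , i)) r = i +ᴬ α j r

  -- A bin W with the position inside it, or a leftover unit.
  part : V → Rᴬ → W × (Rᴬ ⊎ D) ⊎ U
  part (inj₁ e)       r = inj₁ (e , inj₁ r)
  part (inj₂ (q , i)) r = map₁ (map id inj₂) (slot (q , r))

  -- Rows `inj₁ r` of a bin that agree in `α j` are told apart by a second column, `α (other j)`;
  -- each added unit has its own label.
  label : J → Rᴬ ⊎ D → B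
  label j (inj₁ r) = ι (inj₁ (α (other j) r))
  label j (inj₂ d) = ι (inj₂ d)

  x-orth : ∀ v → OrthogonalColumns (λ j → x j v)
  x-orth (inj₁ e)       j≢j′ eq eq′ = α-orth j≢j′ eq eq′
  x-orth (inj₂ (q , i)) j≢j′ eq eq′ =
    α-orth j≢j′ (+ᴬ-cancelˡ i eq) (+ᴬ-cancelˡ i eq′)

  -- A unit fixes `q` and `r`, so right cancellation recovers `i`.
  same-unit : ∀ j {q q′ i i′ r r′} → slot (q , r) ≡ slot (q′ , r′) →
              i +ᴬ α j r ≡ i′ +ᴬ α j r′ → (inj₂ (q , i) , r) ≡ ((V × Rᴬ) ∋ (inj₂ (q′ , i′) , r′))
  same-unit j {q} {r = r} s≡s′ eq with refl ← slot-inj s≡s′ =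
    cong (λ i → inj₂ (q , i) , r) (+ᴬ-cancelʳ (α j r) eq)

  -- Injectivity of `ι` keeps the two kinds of label apart. Two labels of the first kind reduce to
  -- orthogonality of `α j` and `α (other j)`, two of the second kind to a common unit.
  bin-inj : ∀ j v v′ r r′ {e l l′} → part v r ≡ inj₁ (e , l) → part v′ r′ ≡ inj₁ (e , l′) →
            x j v r ≡ x j v′ r′ → label j l ≡ label j l′ → (v , r) ≡ (v′ , r′)
  bin-inj j (inj₁ e) (inj₁ .e) r r′ refl refl x≡ l≡ =
    cong (inj₁ e ,_) (α-orth (other-≢ j) x≡ (inj₁-injective (ι-inj l≡)))
  bin-inj j (inj₁ e) (inj₂ (q , i)) r r′ refl p≡ x≡ l≡ with slot (q , r′) | p≡
  ... | inj₁ (.e , d) | refl = contradiction (ι-inj l≡) λ ()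
  bin-inj j (inj₂ (q , i)) (inj₁ e) r r′ p≡ refl x≡ l≡ with slot (q , r) | p≡
  ... | inj₁ (.e , d) | refl = contradiction (ι-inj l≡) λ ()
  bin-inj j (inj₂ (q , i)) (inj₂ (q′ , i′)) r r′ p≡ p′≡ x≡ l≡
    with slot (q , r) in s≡ | slot (q′ , r′) in s′≡ | p≡ | p′≡
  ... | inj₁ (e , d) | inj₁ (.e , d′) | refl | refl with refl ← ι-inj l≡ =
    same-unit j (trans s≡ (sym s′≡)) x≡

  unit-inj : ∀ j v v′ r r′ {u} → part v r ≡ inj₂ u → part v′ r′ ≡ inj₂ u →
             x j v r ≡ x j v′ r′ → (v , r) ≡ (v′ , r′)
  unit-inj j (inj₂ (q , i)) (inj₂ (q′ , i′)) r r′ p≡ p′≡ x≡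
    with slot (q , r) in s≡ | slot (q′ , r′) in s′≡ | p≡ | p′≡
  ... | inj₂ u | inj₂ .u | refl | refl = same-unit j (trans s≡ (sym s′≡)) x≡

  Row : Set
  Row = Rᴬ × Rᴮ × Rᶜ

  translate : J → W × (Rᴬ ⊎ D) ⊎ U → B → B
  translate j (inj₁ (e , l)) y = label j l +ᴮ y
  translate j (inj₂ u)       y = y

  translate-inj : ∀ j z → Inj (translate j z)
  translate-inj j (inj₁ (e , l)) = +ᴮ-cancelˡ (label j l)
  translate-inj j (inj₂ u)       = id

  class : W × (Rᴬ ⊎ D) ⊎ U → Rᴮ → W × Rᴮ ⊎ U × B
  class (inj₁ (e , l)) s = inj₁ (e , s)
  class (inj₂ u)       s = inj₂ (u , β* s)

  column : J → Row → A × B × C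
  column j (r , s , t) = x j (γ* t) r , translate j (part (γ* t) r) (β j s) , γ j t

  column* : Row → W × Rᴮ ⊎ U × B
  column* (r , s , t) = class (part (γ* t) r) s

  -- The components are recovered in the order `t`, `r`, `s`: the translations cancel once `t` and
  -- `r` fix the part.
  column-orth : OrthogonalColumns column
  column-orth {j} {j′} j≢j′ {r , s , t} eq eq′
    with refl ← γ-orth j≢j′ (cong (proj₂ ∘ proj₂) eq) (cong (proj₂ ∘ proj₂) eq′)
    with refl ← x-orth (γ* t) j≢j′ (cong proj₁ eq) (cong proj₁ eq′)
    with refl ← β-orth j≢j′
           (translate-inj j (part (γ* t) r) (cong (proj₁ ∘ proj₂) eq))
           (translate-inj j′ (part (γ* t) r) (cong (proj₁ ∘ proj₂) eq′))
    = refl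

  -- In a bin the class fixes `s`, so cancelling `β j s` leaves equal labels. In a leftover unit
  -- `β j` is untranslated and `β*` separates the values of `s`.
  class-inj : ∀ j v v′ r r′ s s′ → x j v r ≡ x j v′ r′ →
              translate j (part v r) (β j s) ≡ translate j (part v′ r′) (β j s′) →
              class (part v r) s ≡ class (part v′ r′) s′ → (v , r) ≡ (v′ , r′) × s ≡ s′
  class-inj j v v′ r r′ s s′ x≡ y≡ c≡ with part v r in p≡ | part v′ r′ in p′≡
  ... | inj₁ (e , l) | inj₁ (e′ , l′) with refl ← c≡ =
    bin-inj j v v′ r r′ p≡ p′≡ x≡ (+ᴮ-cancelʳ (β j s) y≡) , refl
  ... | inj₂ u | inj₂ u′ with refl ← ,-injectiveˡ (inj₂-injective c≡) =
    unit-inj j v v′ r r′ p≡ p′≡ x≡ , β*-orth j y≡ (,-injectiveʳ (inj₂-injective c≡))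

  -- Here `t` comes last: `class-inj` yields `γ* t`, which together with `γ j t` determines `t`.
  column*-orth : ∀ j → JointlyInjective (column j) column*
  column*-orth j {r , s , t} {r′ , s′ , t′} eq eq*
    with vr≡ , refl ← class-inj j (γ* t) (γ* t′) r r′ s s′
                        (cong proj₁ eq) (cong (proj₁ ∘ proj₂) eq) eq*
    with refl ← ,-injectiveʳ vr≡
    with refl ← γ*-orth j (cong (proj₂ ∘ proj₂) eq) (,-injectiveˡ vr≡)
    = refl

-- The construction on finite sets: of the `p * (a * a)` units, `w * d` complete the bins and `r`
-- are left over.

MOLS-product : ∀ k a d w p r .{{_ : NonZero a}} → w * d + r ≡ p * (a * a) →
               MOLS k a → MOLS (suc k) (a + d) → MOLS (suc k) (w + p * a) →
               MOLS (suc k) (a * (a + d) * (w + p * a))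
MOLS-product k a@(suc _) d w p r wd+r≡paa MA MB MC =
  OrthogonalColumns⇒MOLS (λ j → col j ∘ row) λ j≢j′ eq eq′ → row-inj (col-orth j≢j′ eq eq′)
  where
  b = a + d
  c = w + p * a
  N = a * b * c

  other : Fin (2 + k) → Fin (2 + k)
  other zero    = suc zero
  other (suc _) = zero

  other-≢ : ∀ j → j ≢ other j
  other-≢ zero    ()
  other-≢ (suc _) ()

  β = squareColumns (proj₁ MB)
  γ = squareColumns (proj₁ MC)

  β-orth : OrthogonalColumns β
  β-orth = MOLS⇒OrthogonalColumns MB

  γ-orth : OrthogonalColumns γ
  γ-orth = MOLS⇒OrthogonalColumns MC

  splitC : Fin c → Fin w ⊎ Fin p × Fin a
  splitC = Sum.map id (remQuot a) ∘ splitAt w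

  splitC-inj : Inj splitC
  splitC-inj = splitAt-Inj w ∘ ⊎-Inj id (remQuot-Inj a)

  slot : Fin p × Fin a × Fin a → (Fin w × Fin d) ⊎ Fin r
  slot = map₁ (remQuot d) ∘ splitAt (w * d) ∘ cast (sym wd+r≡paa)
           ∘ uncurry combine ∘ map id (uncurry combine)

  slot-inj : Inj slot
  slot-inj = ×-Inj id combine-Inj ∘ combine-Inj ∘ cast-Inj (sym wd+r≡paa)
               ∘ splitAt-Inj (w * d) ∘ ⊎-Inj (remQuot-Inj d) id

  -- Column `zero` of `β` and of `γ` is set aside as the extra column, leaving `2 + k` columns
  -- indexed like those of order `a`.
  open Construction other other-≢
    (squareColumns (proj₁ MA)) (MOLS⇒OrthogonalColumns MA)
    (β ∘ suc) (λ j≢j′ → β-orth (j≢j′ ∘ suc-injective))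
    (β zero) (λ j → β-orth {suc j} {zero} (λ ()))
    (γ ∘ suc) (λ j≢j′ → γ-orth (j≢j′ ∘ suc-injective))
    (splitC ∘ γ zero) (λ j eq eq* → γ-orth {suc j} {zero} (λ ()) eq (splitC-inj eq*))
    _⊕_ ⊕-cancelˡ ⊕-cancelʳ
    _⊕_ ⊕-cancelˡ ⊕-cancelʳ
    (join a d) (join-Inj a d)
    slot slot-inj

  encode : Fin a × Fin b × Fin c → Fin N
  encode (x , y , z) = combine (combine x y) z

  encode-inj : Inj encode
  encode-inj {x , y , z} {x′ , y′ , z′} eq
    with xy≡ , refl ← combine-injective (combine x y) z (combine x′ y′) z′ eq
    with refl , refl ← combine-injective x y x′ y′ xy≡
    = refl

  -- Ensures that the parallel classes can be the symbols of a column of order `N`.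
  classes : w * (b * b) + r * b ≡ N
  classes = begin
    w * (b * b) + r * b         ≡⟨ regroup a d w r ⟩
    (w * d + r + w * a) * b     ≡⟨ cong (λ z → (z + w * a) * b) wd+r≡paa ⟩
    (p * (a * a) + w * a) * b   ≡⟨ factor a b w p ⟩
    a * b * (w + p * a)         ∎
    where
    open ≡-Reasoning
    regroup : ∀ a d w r → w * ((a + d) * (a + d)) + r * (a + d) ≡ (w * d + r + w * a) * (a + d)
    regroup = solve-∀
    factor : ∀ a b w p → (p * (a * a) + w * a) * b ≡ a * b * (w + p * a)
    factor = solve-∀

  encode* : Fin w × Fin b × Fin b ⊎ Fin r × Fin b → Fin N
  encode* = cast classes ∘ join _ _
              ∘ Sum.map (uncurry combine ∘ map id (uncurry combine)) (uncurry combine)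

  encode*-inj : Inj encode*
  encode*-inj = ⊎-Inj (×-Inj id combine-Inj ∘ combine-Inj) combine-Inj
                  ∘ join-Inj _ _ ∘ cast-Inj classes

  digits : Fin N → Fin a × Fin b × Fin c
  digits i = let xy , z = remQuot c i ; x , y = remQuot b xy in x , y , z

  digits-inj : Inj digits
  digits-inj eq = remQuot-Inj c
    (cong₂ _,_ (remQuot-Inj b (cong (λ (x , y , z) → x , y) eq)) (cong (proj₂ ∘ proj₂) eq))

  -- Pairing the digits of two indices factor by factor yields one row each of orders `a`, `b` and
  -- `c`.
  row : Fin N × Fin N → Row
  row (i , i′) =
    let x , y , z = digits i ; x′ , y′ , z′ = digits i′
    in (x , x′) , (y , y′) , (z , z′)

  row-inj : Inj row
  row-inj eq = cong₂ _,_
    (digits-inj (cong (λ ((x , _) , (y , _) , (z , _)) → x , y , z) eq))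
    (digits-inj (cong (λ ((_ , x) , (_ , y) , (_ , z)) → x , y , z) eq))

  col : Fin (3 + k) → Row → Fin N
  col zero    = encode* ∘ column*
  col (suc j) = encode ∘ column j

  col-orth : OrthogonalColumns col
  col-orth {zero}  {zero}   j≢j′ _  _   = contradiction refl j≢j′
  col-orth {zero}  {suc j′} _    eq eq′ = column*-orth j′ (encode-inj eq′) (encode*-inj eq)
  col-orth {suc j} {zero}   _    eq eq′ = column*-orth j (encode-inj eq) (encode*-inj eq′)
  col-orth {suc j} {suc j′} j≢j′ eq eq′ =
    column-orth (j≢j′ ∘ cong suc) (encode-inj eq) (encode-inj eq′)

theorem2p2 : (a b c : ℕ) → 1 ≤ a → a ≤ b → b ≤ c →
    (k : ℕ) → k ≤N a → suc k ≤N b → suc k ≤N c → suc k ≤N (a * b * c)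
theorem2p2 a b c 1≤a a≤b b≤c k MA MB MC
  with d , refl ← m≤n⇒∃[o]m+o≡n a≤b = go
  where
  instance
    a≢0 : NonZero a
    a≢0 = >-nonZero 1≤a

  w p : ℕ
  w = c % a
  p = c / a

  c≡w+pa : c ≡ w + p * a
  c≡w+pa = m≡m%n+[m/n]*n c a

  -- Cancel `a` in `a + d ≤ w + p * a ≤ a + p * a`.
  d≤pa : d ≤ p * a
  d≤pa = +-cancelˡ-≤ a d (p * a)
    (≤-trans (subst (a + d ≤_) c≡w+pa b≤c) (+-monoˡ-≤ (p * a) (m%n≤n c a)))

  -- Enough units for all bins, since `w ≤ a`; the difference becomes `r`.
  wd≤paa : w * d ≤ p * (a * a)
  wd≤paa = subst (w * d ≤_) (rearrange a p) (*-mono-≤ (m%n≤n c a) d≤pa)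
    where
    rearrange : ∀ a p → a * (p * a) ≡ p * (a * a)
    rearrange = solve-∀

  go : MOLS (suc k) (a * (a + d) * c)
  go with r , wd+r≡paa ← m≤n⇒∃[o]m+o≡n wd≤paa =
    subst (λ c → MOLS (suc k) (a * (a + d) * c)) (sym c≡w+pa)
      (MOLS-product k a d w p r wd+r≡paa MA MB (subst (MOLS (suc k)) c≡w+pa MC))
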